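{- Let $A,C$ be integers with $AC\neq0$ and let $f(X)=AX+\frac{C}{X}$. Suppose there exists a nonzero rational number $T$ such that the elliptic curve \[E_2:\ Y^2=(X-2ACT^2)(X+2ACT^2)\bigl(X-2AC(2A^2T^4+(4AC-1)T^2+2C^2)\bigr)\] has positive rank over $\mathbb{Q}$. Then the equation $f(x)f(y)=f(z)$ has infinitely many nontrivial rational solutions $(x,y,z)$.
   Context: A solution $(x,y,z)$ (with $x,y,z$ nonzero, so that $f$ is defined) of $f(x)f(y)=f(z)$ is called nontrivial if $x\neq z$, $y\neq z$ and $f(z)\neq 0$. -}

module Defs where

open import Algebra.Bundles.Raw using (RawGroup)
import Algebra.Definitions.RawMonoid as RawMonoidDefs
open import Data.Fin.Base using (Fin)
open import Data.Integer.Base as ℤ using (ℤ; +_; -[1+_])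
open import Data.List.Base using (List)
open import Data.List.Membership.Propositional using (_∉_)
open import Data.Nat.Base using (ℕ; suc)
open import Data.Product.Base using (_×_; _,_; Σ-syntax; ∃-syntax)
open import Data.Rational.Base
open import Data.Rational.Properties
open import Data.Rational.Solver using (module +-*-Solver)
open import Data.Vec.Functional using (Vector)
open import Level using (0ℓ)
open import Relation.Binary.PropositionalEquality
open import Relation.Nullary.Decidable.Core using (yes; no)

fromℤ : ℤ → ℚ
fromℤ n = n / 1

2ℚ 4ℚ : ℚ
2ℚ = fromℤ (+ 2)
4ℚ = fromℤ (+ 4)

Infinite : {X : Set} → (X → Set) → Set
Infinite {X} P = (xs : List X) → ∃[ x ] (P x × x ∉ xs)

------------------------------------------------------------------------
-- The equation f(x) f(y) = f(z)

f : ℤ → ℤ → (x : ℚ) → .{{NonZero x}} → ℚ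
f A C x = fromℤ A * x + fromℤ C ÷ x

record NontrivialSolution (A C : ℤ) (x y z : ℚ) : Set where
  field
    {{x-nonZero}} : NonZero x
    {{y-nonZero}} : NonZero y
    {{z-nonZero}} : NonZero z
    equation      : f A C x * f A C y ≡ f A C z
    x≢z           : x ≢ z
    y≢z           : y ≢ z
    f[z]≢0        : f A C z ≢ 0ℚ

------------------------------------------------------------------------
-- Rank of an abelian group

module _ (G : RawGroup 0ℓ 0ℓ) where

  open RawGroup G
  open RawMonoidDefs rawMonoid using (sum) renaming (_×_ to _×ᴺ_)

  multiple : ℤ → Carrier → Carrier
  multiple (+ n)    P = n ×ᴺ P
  multiple -[1+ n ] P = (suc n ×ᴺ P) ⁻¹

  ℤ-Independent : ∀ {r} → Vector Carrier r → Set
  ℤ-Independent {r} P =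
    (n : Vector ℤ r) → sum (λ i → multiple (n i) (P i)) ≈ ε →
    (i : Fin r) → n i ≡ ℤ.0ℤ

  -- The rank is the supremum of the sizes of ℤ-independent families; such a
  -- family with r members says that the rank is at least r.
  Rank≥ : ℕ → Set
  Rank≥ r = Σ[ P ∈ Vector Carrier r ] ℤ-Independent P

  PositiveRank : Set
  PositiveRank = Rank≥ 1

------------------------------------------------------------------------
-- Plane cubics Y² = (X - e₁)(X - e₂)(X - e₃)

record Cubic : Set where
  constructor cubic
  field
    e₁ e₂ e₃ : ℚ

  g : ℚ → ℚ
  g x = (x - e₁) * (x - e₂) * (x - e₃)

  g′ : ℚ → ℚ
  g′ x = (x - e₂) * (x - e₃) + (x - e₁) * (x - e₃) + (x - e₁) * (x - e₂)

-- Such a cubic over ℚ is smooth exactly when its three roots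
-- are distinct.
record IsElliptic (E : Cubic) : Set where
  open Cubic E
  field
    e₁≢e₂ : e₁ ≢ e₂
    e₁≢e₃ : e₁ ≢ e₃
    e₂≢e₃ : e₂ ≢ e₃

module _ (E : Cubic) where

  open Cubic E

  -- The projective ℚ-points.  The curve equation is an irrelevant argument,
  -- so propositional equality of points is equality of coordinates.
  data Point : Set where
    ∞      : Point
    affine : (x y : ℚ) → .(y * y ≡ g x) → Point

module _ {E : Cubic} where

  open Cubic E

  -- Given a line of slope l through (x₁ , y₁) meeting the cubic at abscissae
  -- x₁ and x₂: the third abscissa, and the ordinate there after reflection.
  thirdX : (l x₁ x₂ : ℚ) → ℚ
  thirdX l x₁ x₂ = l * l + (e₁ + e₂ + e₃) - x₁ - x₂

  thirdY : (l x₁ y₁ x₃ : ℚ) → ℚ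
  thirdY l x₁ y₁ x₃ = l * (x₁ - x₃) - y₁

  private

    open +-*-Solver

    ÷-*-cancel : ∀ p q .{{_ : NonZero q}} → (p ÷ q) * q ≡ p
    ÷-*-cancel p q = trans (*-assoc p (1/ q) q)
      (trans (cong (p *_) (*-inverseˡ q)) (*-identityʳ p))

    x-y≡0⇒x≡y : ∀ x y → x - y ≡ 0ℚ → x ≡ y
    x-y≡0⇒x≡y x y eq = trans
      (solve 2 (λ x y → x := (x :- y) :+ y) refl x y)
      (trans (cong (_+ y) eq) (+-identityˡ y))

    x≡y⇒x-y≡0 : ∀ {x y} → x ≡ y → x - y ≡ 0ℚ
    x≡y⇒x-y≡0 {x} refl = +-inverseʳ x

    *-cancel-0 : ∀ d x .{{_ : NonZero d}} → d * x ≡ 0ℚ → x ≡ 0ℚ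
    *-cancel-0 d x eq = trans (sym (*-identityˡ x))
      (trans (cong (_* x) (sym (*-inverseˡ d)))
      (trans (*-assoc (1/ d) d x) (trans (cong (1/ d *_) eq) (*-zeroʳ (1/ d)))))

    -- g - (line)² is a monic cubic in x, so it is determined by its values at
    -- x₁ and x₂ = x₁ + d together with its quadratic coefficient.
    chord-identity : ∀ x₁ y₁ d l →
      let x₂ = x₁ + d ; y₂ = y₁ + l * d
          x₃ = thirdX l x₁ x₂ ; y₃ = thirdY l x₁ y₁ x₃ in
      d * (y₃ * y₃ - g x₃) ≡
        (y₁ * y₁ - g x₁) * (x₂ - x₃) + (y₂ * y₂ - g x₂) * (x₃ - x₁)
    chord-identity x₁ y₁ d l = solve 7 (λ x₁ y₁ d l e₁ e₂ e₃ →
      let x₂ = x₁ :+ d ; y₂ = y₁ :+ l :* d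
          x₃ = l :* l :+ (e₁ :+ e₂ :+ e₃) :- x₁ :- x₂
          y₃ = l :* (x₁ :- x₃) :- y₁
          G  = λ x → (x :- e₁) :* (x :- e₂) :* (x :- e₃) in
      d :* (y₃ :* y₃ :- G x₃) :=
        (y₁ :* y₁ :- G x₁) :* (x₂ :- x₃) :+ (y₂ :* y₂ :- G x₂) :* (x₃ :- x₁))
      refl x₁ y₁ d l e₁ e₂ e₃

    tangent-identity : ∀ x y l →
      let x₃ = thirdX l x x ; y₃ = thirdY l x y x₃ in
      y₃ * y₃ - g x₃ ≡ (y * y - g x) + (l * (2ℚ * y) - g′ x) * (x₃ - x)
    tangent-identity x y l = solve 6 (λ x y l e₁ e₂ e₃ →
      let x₃ = l :* l :+ (e₁ :+ e₂ :+ e₃) :- x :- x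
          y₃ = l :* (x :- x₃) :- y
          G  = λ x → (x :- e₁) :* (x :- e₂) :* (x :- e₃)
          G′ = (x :- e₂) :* (x :- e₃) :+ (x :- e₁) :* (x :- e₃)
                 :+ (x :- e₁) :* (x :- e₂) in
      y₃ :* y₃ :- G x₃ :=
        (y :* y :- G x) :+ (l :* (con 2ℚ :* y) :- G′) :* (x₃ :- x))
      refl x y l e₁ e₂ e₃

    combination-0 : ∀ {a b} p q → a ≡ 0ℚ → b ≡ 0ℚ → a * p + b * q ≡ 0ℚ
    combination-0 p q refl refl =
      trans (cong₂ _+_ (*-zeroˡ p) (*-zeroˡ q)) (+-identityˡ 0ℚ)

    x+[y-x]≡y : ∀ x y → x + (y - x) ≡ y
    x+[y-x]≡y = solve 2 (λ x y → x :+ (y :- x) := y) refl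

    chord-closed : ∀ x₁ y₁ x₂ y₂ l .{{_ : NonZero (x₂ - x₁)}} →
      l * (x₂ - x₁) ≡ y₂ - y₁ → y₁ * y₁ ≡ g x₁ → y₂ * y₂ ≡ g x₂ →
      let x₃ = thirdX l x₁ x₂ ; y₃ = thirdY l x₁ y₁ x₃ in y₃ * y₃ ≡ g x₃
    chord-closed x₁ y₁ x₂ y₂ l slope h₁ h₂ =
      subst (λ t → let x₃ = thirdX l x₁ t ; y₃ = thirdY l x₁ y₁ x₃ in
                   y₃ * y₃ ≡ g x₃)
        (x+[y-x]≡y x₁ x₂)
        (x-y≡0⇒x≡y _ _ (*-cancel-0 d _
          (trans (chord-identity x₁ y₁ d l)
            (combination-0 _ _ (x≡y⇒x-y≡0 h₁) (x≡y⇒x-y≡0 h₂′)))))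
      where
      d = x₂ - x₁
      h₂′ : (y₁ + l * d) * (y₁ + l * d) ≡ g (x₁ + d)
      h₂′ = subst₂ (λ y x → y * y ≡ g x)
        (sym (trans (cong (λ t → y₁ + t) slope) (x+[y-x]≡y y₁ y₂)))
        (sym (x+[y-x]≡y x₁ x₂)) h₂

    tangent-closed : ∀ x y l → l * (2ℚ * y) ≡ g′ x → y * y ≡ g x →
      let x₃ = thirdX l x x ; y₃ = thirdY l x y x₃ in y₃ * y₃ ≡ g x₃
    tangent-closed x y l slope h = x-y≡0⇒x≡y _ _
      (trans (tangent-identity x y l)
      (trans (cong₂ (λ a b → a + b * (thirdX l x x - x))
                    (x≡y⇒x-y≡0 h) (x≡y⇒x-y≡0 slope))
      (trans (+-identityˡ (0ℚ * (thirdX l x x - x))) (*-zeroˡ (thirdX l x x - x)))))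

    neg-closed : ∀ x y → y * y ≡ g x → (- y) * (- y) ≡ g x
    neg-closed x y h = trans (solve 1 (λ y → (:- y) :* (:- y) := y :* y) refl y) h

    x₂-x₁≢0 : ∀ {x₁ x₂} → x₁ ≢ x₂ → NonZero (x₂ - x₁)
    x₂-x₁≢0 {x₁} {x₂} x₁≢x₂ =
      ≢-nonZero (λ eq → x₁≢x₂ (sym (x-y≡0⇒x≡y x₂ x₁ eq)))

  negate : Point E → Point E
  negate ∞              = ∞
  negate (affine x y h) = affine x (- y) (neg-closed x y h)

  double : Point E → Point E
  double ∞ = ∞
  double (affine x y h) with 2ℚ * y ≟ 0ℚ
  ... | yes _    = ∞
  ... | no 2y≢0 =
    affine x₃ (thirdY l x y x₃)
      (tangent-closed x y l (÷-*-cancel (g′ x) (2ℚ * y)) h)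
    where
    instance _ = ≢-nonZero 2y≢0
    l x₃ : ℚ
    l  = g′ x ÷ (2ℚ * y)
    x₃ = thirdX l x x

  add : Point E → Point E → Point E
  add ∞                 Q                 = Q
  add P@(affine _ _ _)  ∞                 = P
  add P@(affine x₁ y₁ h₁) (affine x₂ y₂ h₂) with x₁ ≟ x₂ | y₁ ≟ y₂
  ... | yes _    | yes _ = double P
  ... | yes _    | no _  = ∞
  ... | no x₁≢x₂ | _     =
    affine x₃ (thirdY l x₁ y₁ x₃)
      (chord-closed x₁ y₁ x₂ y₂ l (÷-*-cancel (y₂ - y₁) (x₂ - x₁)) h₁ h₂)
    where
    instance _ = x₂-x₁≢0 x₁≢x₂
    l x₃ : ℚ
    l  = (y₂ - y₁) ÷ (x₂ - x₁)
    x₃ = thirdX l x₁ x₂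

-- E(ℚ) with the chord–tangent operations.
pointGroup : Cubic → RawGroup 0ℓ 0ℓ
pointGroup E = record
  { Carrier = Point E
  ; _≈_     = _≡_
  ; _∙_     = add
  ; ε       = ∞
  ; _⁻¹     = negate
  }

E₂ : ℤ → ℤ → ℚ → Cubic
E₂ A C T = cubic
  (2ℚ * a * c * (T * T))
  (- (2ℚ * a * c * (T * T)))
  (2ℚ * a * c *
    (2ℚ * (a * a) * (T * T * T * T) + (4ℚ * a * c - 1ℚ) * (T * T)
      + 2ℚ * (c * c)))
  where
  a c : ℚ
  a = fromℤ A
  c = fromℤ C

-- Put y = T, m = T f(T) = a T² + c and q = x f(x) = a x² + c.  The equation
-- f(x) f(T) = f(z) becomes a T x z² - q m z + c T x = 0, which has a rational
-- root z exactly when w² = m² q² - 4 a c T² x² for some rational w.  This quartic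
-- in (x , w) is birational to E₂: the abscissa x is the slope of the line from
-- (e₁ , 0) to the point of E₂, divided by 2 a m.  So every x arises from at most
-- two points, and only finitely many x (those with x = 0, q = 0 or q = x) give
-- trivial solutions, because e₁ ≠ e₃ and e₂ ≠ e₃ force m ≠ T and m ≠ 0.
--
-- That a point P of infinite order has infinitely many multiples needs no
-- associativity of the group law, only the cancellation (- P) + (P + Q) = Q.

module Submission where

open import Algebra.Bundles.Raw using (RawGroup)
import Algebra.Definitions.RawMonoid as RawMonoidDefs
import Algebra.Properties.Group as GroupProperties
open import Data.Empty using (⊥)
open import Data.Fin.Base using (Fin; zero; toℕ)
open import Data.Fin.Properties using (pigeonhole; ¬∀⟶∃¬)
open import Data.Integer.Base as ℤ using (ℤ; +_)
open import Data.Integer.GCD using (gcd)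
import Data.Integer.Properties as ℤₚ
open import Data.List.Base using (List; []; _∷_; length; lookup; map)
open import Data.List.Membership.Propositional using (_∈_; _∉_)
open import Data.List.Membership.Propositional.Properties using (∈-map⁺)
open import Data.List.Relation.Unary.Any using (here; there; any?; index)
open import Data.List.Relation.Unary.Any.Properties using (lookup-index)
open import Data.Nat.Base using (ℕ; zero; suc)
open import Data.Nat.Properties using (n<1+n; <⇒≢)
open import Data.Product.Base using (_×_; _,_; proj₁; ∃-syntax)
open import Data.Rational.Base as Rat using (ℚ; 0ℚ; 1ℚ)
import Data.Rational.Properties as ℚₚ
open import Data.Rational.Solver using (module +-*-Solver)
open import Data.Sum.Base using (_⊎_; inj₁; inj₂; [_,_]′; reduce) renaming (map to map⊎)
open import Defs
open import Function.Base using (_∘_)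
open import Relation.Binary.Definitions using (DecidableEquality)
open import Relation.Binary.PropositionalEquality
  using (_≡_; _≢_; refl; sym; trans; cong; cong₂)
open import Relation.Nullary using (¬_; Dec; recompute; yes; no; contradiction)
open import Relation.Unary using (Decidable)

-- Infinite predicates and maps with small fibres.

module _ {X : Set} where

  -- Pigeonhole: if the first `length xs + 1` terms all lay in `xs`, two of them would sit at the
  -- same position. Decidable membership turns this refutation into an actual term outside `xs`.
  infinite-range : DecidableEquality X → (s : ℕ → X) → (∀ {m n} → s m ≡ s n → m ≡ n) →
                   Infinite (λ x → ∃[ n ] s n ≡ x)
  infinite-range _≟_ s s-injective xs =
    let i , sᵢ∉xs = ¬∀⟶∃¬ _ _ (λ i → any? (s (toℕ i) ≟_) xs) not-all in
    s (toℕ i) , (toℕ i , refl) , sᵢ∉xs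
    where
    not-all : ¬ ((i : Fin (suc (length xs))) → s (toℕ i) ∈ xs)
    not-all s∈xs =
      let i , j , i<j , eq = pigeonhole (n<1+n _) (λ i → index (s∈xs i)) in
      <⇒≢ i<j (s-injective (trans (lookup-index (s∈xs i))
        (trans (cong (lookup xs) eq) (sym (lookup-index (s∈xs j))))))

  -- Stated for three arbitrary elements because this is what a quadratic equation yields, even when
  -- its roots are not known.
  AtMostTwo : (X → Set) → Set
  AtMostTwo P = ∀ {x y z} → P x → P y → P z → x ≡ y ⊎ x ≡ z ⊎ y ≡ z

  -- Each bad element found is added to the excluded list, so a third bad one would be distinct from
  -- the first two.
  infinite-avoiding : {P B : X → Set} → Decidable B → AtMostTwo (λ x → P x × B x) →
                      Infinite P → Infinite (λ x → P x × ¬ B x)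
  infinite-avoiding B? B≤2 inf xs
    with x , Px , x∉ ← inf xs
    with B? x
  ... | no ¬Bx = x , (Px , ¬Bx) , x∉
  ... | yes Bx
    with y , Py , y∉ ← inf (x ∷ xs)
    with B? y
  ... | no ¬By = y , (Py , ¬By) , y∉ ∘ there
  ... | yes By
    with z , Pz , z∉ ← inf (x ∷ y ∷ xs)
    with B? z
  ... | no ¬Bz = z , (Pz , ¬Bz) , z∉ ∘ there ∘ there
  ... | yes Bz with B≤2 (Px , Bx) (Py , By) (Pz , Bz)
  ...   | inj₁ x≡y        = contradiction (here (sym x≡y)) y∉
  ...   | inj₂ (inj₁ x≡z) = contradiction (here (sym x≡z)) z∉
  ...   | inj₂ (inj₂ y≡z) = contradiction (there (here (sym y≡z))) z∉

  -- The fibres over the members of `ys` are removed one at a time; each removal costs at most two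
  -- elements.
  infinite-image : {Y : Set} → DecidableEquality Y → {P : X → Set} (φ : X → Y) →
                   (∀ y → AtMostTwo (λ x → P x × φ x ≡ y)) →
                   Infinite P → Infinite (λ y → ∃[ x ] (P x × φ x ≡ y))
  infinite-image {Y} _≟_ {P} φ fibres≤2 inf ys =
    let x , (Px , φx∉ys) , _ = avoiding ys [] in φ x , (x , Px , refl) , φx∉ys
    where
    avoiding : (ys : List Y) → Infinite (λ x → P x × φ x ∉ ys)
    avoiding []       xs = let x , Px , x∉ = inf xs in x , (Px , λ ()) , x∉
    avoiding (y ∷ ys) xs =
      let x , ((Px , φx∉) , φx≢y) , x∉ = infinite-avoiding (λ x → φ x ≟ y)
            (λ ((Px , _) , p) ((Py , _) , q) ((Pz , _) , r) →
              fibres≤2 y (Px , p) (Py , q) (Pz , r))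
            (avoiding ys) xs in
      x , (Px , λ { (here eq) → φx≢y eq ; (there ∈ys) → φx∉ ∈ys }) , x∉

-- Field arithmetic and quadratic equations over the rationals.

module Field where

  open Rat using (_+_; _-_; -_; _*_; _÷_; 1/_; NonZero; ≢-nonZero)
  open ℚₚ
  open +-*-Solver

  open GroupProperties +-0-group public
    using () renaming (x∙y⁻¹≈ε⇒x≈y to x-y≡0⇒x≡y; x≈y⇒x∙y⁻¹≈ε to x≡y⇒x-y≡0)

  ÷-*-cancel : ∀ p q .{{_ : NonZero q}} → (p ÷ q) * q ≡ p
  ÷-*-cancel p q = trans (*-assoc p (1/ q) q)
    (trans (cong (p *_) (*-inverseˡ q)) (*-identityʳ p))

  *-÷-cancel : ∀ p q .{{_ : NonZero q}} → (p * q) ÷ q ≡ p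
  *-÷-cancel p q = trans (*-assoc p q (1/ q))
    (trans (cong (p *_) (*-inverseʳ q)) (*-identityʳ p))

  *-cancelʳ : ∀ {p q r} → r ≢ 0ℚ → p * r ≡ q * r → p ≡ q
  *-cancelʳ {p} {q} {r} r≢0 eq = trans (sym (*-÷-cancel p r))
    (trans (cong (_÷ r) eq) (*-÷-cancel q r))
    where instance _ = ≢-nonZero r≢0

  -- Made total, with an arbitrary value at 0, so that slopes become a plain function on points.
  inverse : ℚ → ℚ
  inverse p with p ≟ 0ℚ
  ... | yes _   = 0ℚ
  ... | no p≢0 = (1/ p) {{≢-nonZero p≢0}}

  inverseˡ : ∀ {p} → p ≢ 0ℚ → inverse p * p ≡ 1ℚ
  inverseˡ {p} p≢0 with p ≟ 0ℚ
  ... | yes p≡0 = contradiction p≡0 p≢0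
  ... | no p≢0′ = *-inverseˡ p {{≢-nonZero p≢0′}}

  p*q≡0⇒p≡0∨q≡0 : ∀ p q → p * q ≡ 0ℚ → p ≡ 0ℚ ⊎ q ≡ 0ℚ
  p*q≡0⇒p≡0∨q≡0 p q eq with q ≟ 0ℚ
  ... | yes q≡0 = inj₂ q≡0
  ... | no q≢0  = inj₁ (*-cancelʳ q≢0 (trans eq (sym (*-zeroˡ q))))

  *-≢0 : ∀ {p q} → p ≢ 0ℚ → q ≢ 0ℚ → p * q ≢ 0ℚ
  *-≢0 {p} {q} p≢0 q≢0 eq = [ p≢0 , q≢0 ]′ (p*q≡0⇒p≡0∨q≡0 p q eq)

  x-y≢0 : ∀ {x y} → x ≢ y → x - y ≢ 0ℚ
  x-y≢0 x≢y eq = x≢y (x-y≡0⇒x≡y _ _ eq)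

  vanishing : ∀ k {l r} → l ≡ r → k * (l - r) ≡ 0ℚ
  vanishing k l≡r = trans (cong (k *_) (x≡y⇒x-y≡0 l≡r)) (*-zeroʳ k)

  -- Certificate format for consequences of equations: `p - q` is an explicit combination of
  -- differences known to vanish, which leaves only a polynomial identity for `solve`.
  combine₁ : ∀ k {p q l r} → p - q ≡ k * (l - r) → l ≡ r → p ≡ q
  combine₁ k {p} {q} eq l≡r = x-y≡0⇒x≡y p q (trans eq (vanishing k l≡r))

  combine₂ : ∀ k k′ {p q l r l′ r′} → p - q ≡ k * (l - r) + k′ * (l′ - r′) →
             l ≡ r → l′ ≡ r′ → p ≡ q
  combine₂ k k′ {p} {q} eq l≡r l′≡r′ = x-y≡0⇒x≡y p q
    (trans eq (cong₂ _+_ (vanishing k l≡r) (vanishing k′ l′≡r′)))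

  combine₃ : ∀ k k′ k″ {p q l r l′ r′ l″ r″} →
             p - q ≡ k * (l - r) + k′ * (l′ - r′) + k″ * (l″ - r″) →
             l ≡ r → l′ ≡ r′ → l″ ≡ r″ → p ≡ q
  combine₃ k k′ k″ {p} {q} eq l≡r l′≡r′ l″≡r″ = x-y≡0⇒x≡y p q
    (trans eq (cong₂ _+_ (cong₂ _+_ (vanishing k l≡r) (vanishing k′ l′≡r′))
                         (vanishing k″ l″≡r″)))

  -- If `r` differs from `s` and from `t`, both pairs satisfy Vieta's formula for the sum of the
  -- roots, hence `s` and `t` agree.
  quadratic-roots : ∀ a b c → a ≢ 0ℚ → ∀ r s t →
    a * (r * r) + b * r + c ≡ 0ℚ → a * (s * s) + b * s + c ≡ 0ℚ →
    a * (t * t) + b * t + c ≡ 0ℚ → r ≡ s ⊎ r ≡ t ⊎ s ≡ t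
  quadratic-roots a b c a≢0 r s t r-root s-root t-root
    with r ≟ s | r ≟ t
  ... | yes r≡s | _       = inj₁ r≡s
  ... | no _    | yes r≡t = inj₂ (inj₁ r≡t)
  ... | no r≢s  | no r≢t  = inj₂ (inj₂ (*-cancelʳ a≢0
    (combine₂ 1ℚ (- 1ℚ)
      (solve 5 (λ a b r s t → s :* a :- t :* a :=
        con 1ℚ :* (a :* (r :+ s) :+ b :- con 0ℚ) :+
        con (- 1ℚ) :* (a :* (r :+ t) :+ b :- con 0ℚ)) refl a b r s t)
      (sum-of-roots s r≢s s-root) (sum-of-roots t r≢t t-root))))
    where
    sum-of-roots : ∀ u → r ≢ u → a * (u * u) + b * u + c ≡ 0ℚ →
                   a * (r + u) + b ≡ 0ℚ
    sum-of-roots u r≢u u-root = *-cancelʳ (λ eq → r≢u (x-y≡0⇒x≡y r u eq))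
      (combine₂ 1ℚ (- 1ℚ)
        (solve 5 (λ a b c r u →
          (a :* (r :+ u) :+ b) :* (r :- u) :- con 0ℚ :* (r :- u) :=
          con 1ℚ :* (a :* (r :* r) :+ b :* r :+ c :- con 0ℚ) :+
          con (- 1ℚ) :* (a :* (u :* u) :+ b :* u :+ c :- con 0ℚ)) refl a b c r u)
        r-root u-root)

-- The chord-tangent law and its cancellation property.

module ChordTangent (E : Cubic) (elliptic : IsElliptic E) where

  open Rat using (_+_; _-_; -_; _*_; _÷_; ≢-nonZero)
  open ℚₚ using (_≟_)
  open +-*-Solver
  open Cubic E
  open IsElliptic elliptic
  open Field

  affine-≡ : ∀ {x y x′ y′} .{h : y * y ≡ g x} .{h′ : y′ * y′ ≡ g x′} →
             x ≡ x′ → y ≡ y′ → affine {E} x y h ≡ affine x′ y′ h′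
  affine-≡ refl refl = refl

  -- Lets `l` be any solution of the division-free slope equation in place of the quotient computed
  -- by `add`, and hides the coordinates of the sum behind equations.
  add-chord-elim : (B : Point E → Set) → ∀ {x₁ y₁ x₂ y₂} .{h₁ h₂} l →
    x₁ ≢ x₂ → l * (x₂ - x₁) ≡ y₂ - y₁ →
    (∀ {x₃ y₃} .{h₃} → thirdX {E} l x₁ x₂ ≡ x₃ → thirdY {E} l x₁ y₁ x₃ ≡ y₃ →
      B (affine x₃ y₃ h₃)) →
    B (add (affine x₁ y₁ h₁) (affine x₂ y₂ h₂))
  add-chord-elim B {x₁} {y₁} {x₂} {y₂} l x₁≢x₂ slope b with x₁ ≟ x₂ | y₁ ≟ y₂
  ... | yes x₁≡x₂ | _ = contradiction x₁≡x₂ x₁≢x₂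
  ... | no _      | _ =
    b (cong X (sym l′≡l)) (cong (λ l → thirdY {E} l x₁ y₁ (X l′)) (sym l′≡l))
    where
    X : ℚ → ℚ
    X l = thirdX {E} l x₁ x₂
    x₂-x₁≢0 : x₂ - x₁ ≢ 0ℚ
    x₂-x₁≢0 = x-y≢0 (λ eq → x₁≢x₂ (sym eq))
    instance _ = ≢-nonZero x₂-x₁≢0
    l′ : ℚ
    l′ = (y₂ - y₁) ÷ (x₂ - x₁)
    l′≡l : l′ ≡ l
    l′≡l = *-cancelʳ x₂-x₁≢0 (trans (÷-*-cancel _ _) (sym slope))

  add-tangent-elim : (B : Point E → Set) → ∀ {x y} .{h} l →
    y ≢ 0ℚ → l * (2ℚ * y) ≡ g′ x →
    (∀ {x₃ y₃} .{h₃} → thirdX {E} l x x ≡ x₃ → thirdY {E} l x y x₃ ≡ y₃ →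
      B (affine x₃ y₃ h₃)) →
    B (add (affine x y h) (affine x y h))
  add-tangent-elim B {x} {y} l y≢0 slope b with x ≟ x | y ≟ y
  ... | no x≢x | _      = contradiction refl x≢x
  ... | yes _  | no y≢y = contradiction refl y≢y
  ... | yes _  | yes _ with 2ℚ * y ≟ 0ℚ
  ...   | yes 2y≡0 = contradiction 2y≡0 (*-≢0 {2ℚ} (λ ()) y≢0)
  ...   | no 2y≢0  =
    b (cong X (sym l′≡l)) (cong (λ l → thirdY {E} l x y (X l′)) (sym l′≡l))
    where
    X : ℚ → ℚ
    X l = thirdX {E} l x x
    instance _ = ≢-nonZero 2y≢0
    l′ : ℚ
    l′ = g′ x ÷ (2ℚ * y)
    l′≡l : l′ ≡ l
    l′≡l = *-cancelʳ 2y≢0 (trans (÷-*-cancel _ _) (sym slope))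

  -- This includes the points of order two, where `add` passes to `double`: there `y₁ ≡ y₂` and
  -- `y₁ ≡ - y₂` force `2ℚ * y₁ ≡ 0ℚ`.
  add-vertical : ∀ {x y₁ y₂} .{h₁ h₂} → y₁ ≡ - y₂ →
                 add {E} (affine x y₁ h₁) (affine x y₂ h₂) ≡ ∞
  add-vertical {x} {y₁} {y₂} y₁≡-y₂ with x ≟ x | y₁ ≟ y₂
  ... | no x≢x | _ = contradiction refl x≢x
  ... | yes _ | no _ = refl
  ... | yes _ | yes refl with 2ℚ * y₁ ≟ 0ℚ
  ...   | yes _    = refl
  ...   | no 2y≢0 = contradiction
    (combine₁ 1ℚ (solve 1 (λ y → con 2ℚ :* y :- con 0ℚ :=
      con 1ℚ :* (y :- :- y)) refl y₁) y₁≡-y₂) 2y≢0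

  y²≡y²⇒y≡±y : ∀ y₁ y₂ → y₁ * y₁ ≡ y₂ * y₂ → y₁ ≡ y₂ ⊎ y₁ ≡ - y₂
  y²≡y²⇒y≡±y y₁ y₂ eq = map⊎ (x-y≡0⇒x≡y _ _) (x-y≡0⇒x≡y _ _)
    (p*q≡0⇒p≡0∨q≡0 (y₁ - y₂) (y₁ - - y₂)
      (combine₁ 1ℚ (solve 2 (λ y₁ y₂ → (y₁ :- y₂) :* (y₁ :- :- y₂) :- con 0ℚ :=
        con 1ℚ :* (y₁ :* y₁ :- y₂ :* y₂)) refl y₁ y₂) eq))

  g-roots : ∀ x → g x ≡ 0ℚ → x ≡ e₁ ⊎ x ≡ e₂ ⊎ x ≡ e₃
  g-roots x gx≡0 with p*q≡0⇒p≡0∨q≡0 ((x - e₁) * (x - e₂)) (x - e₃) gx≡0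
  ... | inj₂ eq = inj₂ (inj₂ (x-y≡0⇒x≡y x e₃ eq))
  ... | inj₁ eq with p*q≡0⇒p≡0∨q≡0 (x - e₁) (x - e₂) eq
  ...   | inj₁ eq′ = inj₁ (x-y≡0⇒x≡y x e₁ eq′)
  ...   | inj₂ eq′ = inj₂ (inj₁ (x-y≡0⇒x≡y x e₂ eq′))

  -- At a root, the derivative is the product of the differences to the other two roots.
  smooth : ∀ x → g x ≡ 0ℚ → g′ x ≢ 0ℚ
  smooth x gx≡0 g′x≡0 with g-roots x gx≡0
  ... | inj₁ refl = *-≢0 (x-y≢0 e₁≢e₂) (x-y≢0 e₁≢e₃) (combine₁ 1ℚ
    (solve 3 (λ e₁ e₂ e₃ → (e₁ :- e₂) :* (e₁ :- e₃) :- con 0ℚ :=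
      con 1ℚ :* ((e₁ :- e₂) :* (e₁ :- e₃) :+ (e₁ :- e₁) :* (e₁ :- e₃)
        :+ (e₁ :- e₁) :* (e₁ :- e₂) :- con 0ℚ)) refl e₁ e₂ e₃) g′x≡0)
  ... | inj₂ (inj₁ refl) = *-≢0 (x-y≢0 e₁≢e₂) (x-y≢0 e₂≢e₃) (combine₁ (- 1ℚ)
    (solve 3 (λ e₁ e₂ e₃ → (e₁ :- e₂) :* (e₂ :- e₃) :- con 0ℚ :=
      con (- 1ℚ) :* ((e₂ :- e₂) :* (e₂ :- e₃) :+ (e₂ :- e₁) :* (e₂ :- e₃)
        :+ (e₂ :- e₁) :* (e₂ :- e₂) :- con 0ℚ)) refl e₁ e₂ e₃) g′x≡0)
  ... | inj₂ (inj₂ refl) = *-≢0 (x-y≢0 e₁≢e₃) (x-y≢0 e₂≢e₃) (combine₁ 1ℚ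
    (solve 3 (λ e₁ e₂ e₃ → (e₁ :- e₃) :* (e₂ :- e₃) :- con 0ℚ :=
      con 1ℚ :* ((e₃ :- e₂) :* (e₃ :- e₃) :+ (e₃ :- e₁) :* (e₃ :- e₃)
        :+ (e₃ :- e₁) :* (e₃ :- e₂) :- con 0ℚ)) refl e₁ e₂ e₃) g′x≡0)

  -- The line of slope l through (x₁ , y₁) and (x₂ , y₂), tangent there if they
  -- coincide, meets the cubic again at x₃; the last hypothesis compares
  -- derivatives at x₁ in g x - (y₁ + l (x - x₁))² = (x - x₁)(x - x₂)(x - x₃).
  add-negate-third : ∀ {x₁ y₁ x₂ y₂ x₃ y₃} .{h₁ h₂ h₃} l →
    l * (x₂ - x₁) ≡ y₂ - y₁ → thirdX {E} l x₁ x₂ ≡ x₃ → thirdY {E} l x₁ y₁ x₃ ≡ y₃ →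
    y₁ * y₁ ≡ g x₁ → g′ x₁ - l * (2ℚ * y₁) ≡ (x₁ - x₂) * (x₁ - x₃) →
    add (negate (affine x₁ y₁ h₁)) (affine x₃ y₃ h₃) ≡ affine {E} x₂ y₂ h₂
  add-negate-third {x₁} {y₁} {x₂} {y₂} {x₃} {y₃} {h₁} {h₂} {h₃}
                   l slope third-x third-y on-E derivative = by-cases (x₁ ≟ x₃)
    where
    -- Reflecting the line in the x-axis gives a line of slope `- l` through the negative of the
    -- first point and through (x₃ , y₃). It meets the cubic again at (x₂ , - y₂), whose reflection
    -- is the second point.
    x₂-third : (- l) * (- l) + (e₁ + e₂ + e₃) - x₁ - x₃ ≡ x₂
    x₂-third = combine₁ 1ℚ (solve 5 (λ x₁ x₂ x₃ l s →
      (:- l) :* (:- l) :+ s :- x₁ :- x₃ :- x₂ :=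
      con 1ℚ :* (l :* l :+ s :- x₁ :- x₂ :- x₃)) refl x₁ x₂ x₃ l (e₁ + e₂ + e₃))
      third-x

    y₂-third : (- l) * (x₁ - x₂) - - y₁ ≡ y₂
    y₂-third = combine₁ 1ℚ (solve 5 (λ x₁ x₂ y₁ y₂ l →
      (:- l) :* (x₁ :- x₂) :- :- y₁ :- y₂ :=
      con 1ℚ :* (l :* (x₂ :- x₁) :- (y₂ :- y₁))) refl x₁ x₂ y₁ y₂ l) slope

    third-is-Q : ∀ {x y} .{h : y * y ≡ g x} →
      (- l) * (- l) + (e₁ + e₂ + e₃) - x₁ - x₃ ≡ x →
      (- l) * (x₁ - x) - - y₁ ≡ y → affine x y h ≡ affine {E} x₂ y₂ h₂
    third-is-Q eqx eqy = affine-≡ x≡x₂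
      (trans (sym eqy) (trans (cong (λ x → (- l) * (x₁ - x) - - y₁) x≡x₂) y₂-third))
      where x≡x₂ = trans (sym eqx) x₂-third

    chord-slope : (- l) * (x₃ - x₁) ≡ y₃ - - y₁
    chord-slope = combine₁ 1ℚ (solve 5 (λ x₁ y₁ x₃ y₃ l →
      (:- l) :* (x₃ :- x₁) :- (y₃ :- :- y₁) :=
      con 1ℚ :* (l :* (x₁ :- x₃) :- y₁ :- y₃)) refl x₁ y₁ x₃ y₃ l) third-y

    module _ (x₁≡x₃ : x₁ ≡ x₃) where

      y₃≡-y₁ : y₃ ≡ - y₁
      y₃≡-y₁ = combine₂ (- 1ℚ) l (solve 5 (λ x₁ y₁ x₃ y₃ l →
        y₃ :- :- y₁ :=
        con (- 1ℚ) :* (l :* (x₁ :- x₃) :- y₁ :- y₃) :+ l :* (x₁ :- x₃))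
        refl x₁ y₁ x₃ y₃ l) third-y x₁≡x₃

      -- With `x₁ ≡ x₃`, a zero ordinate would make `derivative` say that `g′` vanishes at a root of
      -- `g`.
      -y₁≢0 : - y₁ ≢ 0ℚ
      -y₁≢0 -y₁≡0 = smooth x₁
        (trans (sym on-E) (combine₁ (- y₁) (solve 1 (λ y → y :* y :- con 0ℚ :=
          (:- y) :* ((:- y) :- con 0ℚ)) refl y₁) -y₁≡0))
        (combine₃ 1ℚ (- (l * 2ℚ)) (x₁ - x₂) (solve 6 (λ x₁ x₂ x₃ y l d →
          d :- con 0ℚ :=
          con 1ℚ :* (d :- l :* (con 2ℚ :* y) :- (x₁ :- x₂) :* (x₁ :- x₃))
            :+ (:- (l :* con 2ℚ)) :* ((:- y) :- con 0ℚ)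
            :+ (x₁ :- x₂) :* (x₁ :- x₃)) refl x₁ x₂ x₃ y₁ l (g′ x₁))
          derivative -y₁≡0 x₁≡x₃)

      tangent-slope : (- l) * (2ℚ * (- y₁)) ≡ g′ x₁
      tangent-slope = combine₂ (- 1ℚ) (- (x₁ - x₂)) (solve 6 (λ x₁ x₂ x₃ y l d →
        (:- l) :* (con 2ℚ :* (:- y)) :- d :=
        con (- 1ℚ) :* (d :- l :* (con 2ℚ :* y) :- (x₁ :- x₂) :* (x₁ :- x₃))
          :+ (:- (x₁ :- x₂)) :* (x₁ :- x₃)) refl x₁ x₂ x₃ y₁ l (g′ x₁))
        derivative x₁≡x₃

    by-cases : Dec (x₁ ≡ x₃) →
      add (negate (affine x₁ y₁ h₁)) (affine x₃ y₃ h₃) ≡ affine {E} x₂ y₂ h₂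
    by-cases (no x₁≢x₃) =
      add-chord-elim (_≡ affine x₂ y₂ h₂) (- l) x₁≢x₃ chord-slope third-is-Q
    by-cases (yes x₁≡x₃) = trans
      (cong (add (negate (affine x₁ y₁ h₁))) (affine-≡ (sym x₁≡x₃) (y₃≡-y₁ x₁≡x₃)))
      (add-tangent-elim (_≡ affine x₂ y₂ h₂) (- l) (-y₁≢0 x₁≡x₃) (tangent-slope x₁≡x₃)
        λ eqx → third-is-Q (trans
          (cong (λ x → (- l) * (- l) + (e₁ + e₂ + e₃) - x₁ - x) (sym x₁≡x₃)) eqx))

  -- Supplies the derivative hypothesis of `add-negate-third` for a proper chord; the identity
  -- follows from the two curve equations after multiplication by `x₂ - x₁`.
  chord-derivative : ∀ x₁ y₁ x₂ y₂ l → x₁ ≢ x₂ → l * (x₂ - x₁) ≡ y₂ - y₁ →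
    y₁ * y₁ ≡ g x₁ → y₂ * y₂ ≡ g x₂ →
    g′ x₁ - l * (2ℚ * y₁) ≡ (x₁ - x₂) * (x₁ - thirdX {E} l x₁ x₂)
  chord-derivative x₁ y₁ x₂ y₂ l x₁≢x₂ slope on-E₁ on-E₂ =
    *-cancelʳ (x-y≢0 (λ eq → x₁≢x₂ (sym eq)))
      (combine₃ 1ℚ (- 1ℚ) (- (y₂ + y₁ + l * (x₂ - x₁)))
        (solve 8 (λ x₁ y₁ x₂ y₂ l e₁ e₂ e₃ →
          let G  = λ x → (x :- e₁) :* (x :- e₂) :* (x :- e₃)
              G′ = (x₁ :- e₂) :* (x₁ :- e₃) :+ (x₁ :- e₁) :* (x₁ :- e₃)
                     :+ (x₁ :- e₁) :* (x₁ :- e₂)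
              d  = x₂ :- x₁
          in
          (G′ :- l :* (con 2ℚ :* y₁)) :* d
            :- (x₁ :- x₂) :* (x₁ :- (l :* l :+ (e₁ :+ e₂ :+ e₃) :- x₁ :- x₂)) :* d :=
          con 1ℚ :* (y₁ :* y₁ :- G x₁) :+ con (- 1ℚ) :* (y₂ :* y₂ :- G x₂)
            :+ (:- (y₂ :+ y₁ :+ l :* d)) :* (l :* d :- (y₂ :- y₁)))
          refl x₁ y₁ x₂ y₂ l e₁ e₂ e₃)
        on-E₁ on-E₂ slope)

  add-negate-cancel : ∀ P Q → add (negate P) (add P Q) ≡ Q
  add-negate-cancel ∞ Q = refl
  add-negate-cancel (affine x y h) ∞ = add-vertical {x} { - y} {y} {h₂ = h} refl
  add-negate-cancel P@(affine x₁ y₁ h₁) Q@(affine x₂ y₂ h₂) = by-cases (x₁ ≟ x₂)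
    where
    -- The curve equations are irrelevant fields; decidable equality on ℚ recovers usable proofs.
    on-E₁ : y₁ * y₁ ≡ g x₁
    on-E₁ = recompute (_ ≟ _) h₁
    on-E₂ : y₂ * y₂ ≡ g x₂
    on-E₂ = recompute (_ ≟ _) h₂

    chord : x₁ ≢ x₂ → add (negate P) (add P Q) ≡ Q
    chord x₁≢x₂ = add-chord-elim (λ R → add (negate P) R ≡ Q) l x₁≢x₂ slope
      (λ {_} {_} {h₃} eqx eqy → add-negate-third {h₁ = h₁} {h₂} {h₃} l slope eqx eqy on-E₁
        (trans (chord-derivative x₁ y₁ x₂ y₂ l x₁≢x₂ slope on-E₁ on-E₂)
          (cong (λ x → (x₁ - x₂) * (x₁ - x)) eqx)))
      where
      instance _ = ≢-nonZero (x-y≢0 (λ eq → x₁≢x₂ (sym eq)))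
      l : ℚ
      l = (y₂ - y₁) ÷ (x₂ - x₁)
      slope : l * (x₂ - x₁) ≡ y₂ - y₁
      slope = ÷-*-cancel (y₂ - y₁) (x₂ - x₁)

    opposite : x₁ ≡ x₂ → y₁ ≡ - y₂ → add (negate P) (add P Q) ≡ Q
    opposite refl y₁≡-y₂ = trans (cong (add (negate P)) (add-vertical {x₁} {h₁ = h₁} {h₂} y₁≡-y₂))
      (affine-≡ refl (combine₁ (- 1ℚ) (solve 2 (λ y₁ y₂ → (:- y₁) :- y₂ :=
        con (- 1ℚ) :* (y₁ :- :- y₂)) refl y₁ y₂) y₁≡-y₂))

    tangent : y₁ ≢ 0ℚ → add (negate P) (add P P) ≡ P
    tangent y₁≢0 = add-tangent-elim (λ R → add (negate P) R ≡ P) l y₁≢0 slope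
      (λ {x₃} {_} {h₃} eqx eqy → add-negate-third {h₁ = h₁} {h₁} {h₃} l
        (solve 3 (λ x y l → l :* (x :- x) := y :- y) refl x₁ y₁ l) eqx eqy on-E₁
        (combine₁ (- 1ℚ) (solve 4 (λ x₁ x₃ d d′ →
          d :- d′ :- (x₁ :- x₁) :* (x₁ :- x₃) := con (- 1ℚ) :* (d′ :- d))
          refl x₁ x₃ (g′ x₁) (l * (2ℚ * y₁))) slope))
      where
      instance _ = ≢-nonZero (*-≢0 {2ℚ} (λ ()) y₁≢0)
      l : ℚ
      l = g′ x₁ ÷ (2ℚ * y₁)
      slope : l * (2ℚ * y₁) ≡ g′ x₁
      slope = ÷-*-cancel (g′ x₁) (2ℚ * y₁)

    same : x₁ ≡ x₂ → y₁ ≡ y₂ → Dec (y₁ ≡ 0ℚ) → add (negate P) (add P Q) ≡ Q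
    -- A point with ordinate 0 is its own negative, so the vertical case applies.
    same refl refl (yes refl) = opposite refl refl
    same refl refl (no y₁≢0)  = tangent y₁≢0

    by-cases : Dec (x₁ ≡ x₂) → add (negate P) (add P Q) ≡ Q
    by-cases (no x₁≢x₂)  = chord x₁≢x₂
    by-cases (yes x₁≡x₂) =
      [ (λ eq → same x₁≡x₂ eq (y₁ ≟ 0ℚ)) , opposite x₁≡x₂ ]′
        (y²≡y²⇒y≡±y y₁ y₂ (trans on-E₁ (trans (cong g x₁≡x₂) (sym on-E₂))))

  add-cancelˡ : ∀ P {Q R} → add P Q ≡ add P R → Q ≡ R
  add-cancelˡ P {Q} {R} eq = trans (sym (add-negate-cancel P Q))
    (trans (cong (add (negate P)) eq) (add-negate-cancel P R))

  add-identityʳ : ∀ P → add {E} P ∞ ≡ P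
  add-identityʳ ∞              = refl
  add-identityʳ (affine _ _ _) = refl

  -- Multiples of a point of infinite order.

  open RawMonoidDefs (RawGroup.rawMonoid (pointGroup E)) using () renaming (_×_ to _×ᴺ_)

  -- Cancelling one copy of the point at a time leaves some multiple equal to `∞`, and independence
  -- of the one-member family makes its coefficient zero.
  multiples-injective : ((P , _) : PositiveRank (pointGroup E)) →
    ∀ {m n} → m ×ᴺ P zero ≡ n ×ᴺ P zero → m ≡ n
  multiples-injective (P , independent) = injective _ _
    where
    infinite-order : ∀ n → n ×ᴺ P zero ≡ ∞ → + n ≡ ℤ.0ℤ
    infinite-order n eq =
      independent (λ _ → + n) (trans (add-identityʳ _) eq) zero

    injective : ∀ m n → m ×ᴺ P zero ≡ n ×ᴺ P zero → m ≡ n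
    injective zero    zero    _  = refl
    injective zero    (suc n) eq with () ← infinite-order (suc n) (sym eq)
    injective (suc m) zero    eq with () ← infinite-order (suc m) eq
    injective (suc m) (suc n) eq = cong suc (injective m n (add-cancelˡ (P zero) eq))

  _≟ₚ_ : DecidableEquality (Point E)
  ∞            ≟ₚ ∞               = yes refl
  ∞            ≟ₚ affine _ _ _    = no λ ()
  affine _ _ _ ≟ₚ ∞               = no λ ()
  affine x y _ ≟ₚ affine x′ y′ _ with x ≟ x′ | y ≟ y′
  ... | yes refl | yes refl = yes refl
  ... | no x≢x′  | _        = no λ { refl → x≢x′ refl }
  ... | yes _    | no y≢y′  = no λ { refl → y≢y′ refl }

  Off-e₁ : Point E → Set
  Off-e₁ ∞              = ⊥
  Off-e₁ (affine x _ _) = x ≢ e₁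

  infinite-off-e₁ : PositiveRank (pointGroup E) → Infinite Off-e₁
  infinite-off-e₁ rank@(P , _) xs =
    let R , _ , R∉ = infinite-range _≟ₚ_ (_×ᴺ P zero) (multiples-injective rank)
                       -- These are the only two points to avoid, since `x ≡ e₁` on the curve forces
                       -- `y * y ≡ 0ℚ`.
                       (∞ ∷ affine e₁ 0ℚ e₁-on-E ∷ xs) in
    R , off R R∉ , R∉ ∘ there ∘ there
    where
    e₁-on-E : 0ℚ * 0ℚ ≡ g e₁
    e₁-on-E = solve 3 (λ e₁ e₂ e₃ →
      con 0ℚ :* con 0ℚ := (e₁ :- e₁) :* (e₁ :- e₂) :* (e₁ :- e₃)) refl e₁ e₂ e₃

    off : ∀ R → R ∉ ∞ ∷ affine e₁ 0ℚ e₁-on-E ∷ xs → Off-e₁ R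
    off ∞              R∉ = contradiction (here refl) R∉
    off (affine x y h) R∉ refl = contradiction (there (here (affine-≡ refl y≡0))) R∉
      where
      y≡0 : y ≡ 0ℚ
      y≡0 = reduce (p*q≡0⇒p≡0∨q≡0 y y
        (trans (recompute (_ ≟ _) h) (sym e₁-on-E)))

  -- Slopes of lines through (e₁ , 0).

  module Slopes {κ} (κ≢0 : κ ≢ 0ℚ) where

    -- The slope of the line to (e₁ , 0), divided by κ.
    normalised-slope : Point E → ℚ
    normalised-slope ∞              = 0ℚ
    normalised-slope (affine x y _) = y * inverse (κ * (x - e₁))

    -- The curve equation after substituting y = κ t (x - e₁) and cancelling one factor x - e₁.
    IsSlope : ℚ → ℚ → Set
    IsSlope t x = (κ * t) * (κ * t) * (x - e₁) ≡ (x - e₂) * (x - e₃)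

    slope-ordinate : ∀ {x t} y → x ≢ e₁ → y * inverse (κ * (x - e₁)) ≡ t →
                     y ≡ t * (κ * (x - e₁))
    slope-ordinate {x} y x≢e₁ refl = sym (trans (ℚₚ.*-assoc y _ _)
      (trans (cong (y *_) (inverseˡ (*-≢0 κ≢0 (x-y≢0 x≢e₁)))) (ℚₚ.*-identityʳ y)))

    slope-equation : ∀ {x} y {t} → y * y ≡ g x → x ≢ e₁ →
                     y * inverse (κ * (x - e₁)) ≡ t → IsSlope t x
    slope-equation {x} y {t} on-E x≢e₁ eq = *-cancelʳ (x-y≢0 x≢e₁)
      (combine₂ 1ℚ (- (y + t * (κ * (x - e₁)))) (solve 7 (λ x y t κ e₁ e₂ e₃ →
        κ :* t :* (κ :* t) :* (x :- e₁) :* (x :- e₁)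
          :- (x :- e₂) :* (x :- e₃) :* (x :- e₁) :=
        con 1ℚ :* (y :* y :- (x :- e₁) :* (x :- e₂) :* (x :- e₃))
          :+ (:- (y :+ t :* (κ :* (x :- e₁)))) :* (y :- t :* (κ :* (x :- e₁))))
        refl x y t κ e₁ e₂ e₃)
        on-E (slope-ordinate y x≢e₁ eq))

    -- For fixed `t`, `IsSlope` is a monic quadratic in the abscissa, and the abscissa with `t`
    -- determines the ordinate.
    slope-fibres : ∀ t → AtMostTwo (λ R → Off-e₁ R × normalised-slope R ≡ t)
    slope-fibres t {affine x₁ y₁ h₁} {affine x₂ y₂ h₂} {affine x₃ y₃ h₃}
                 (off₁ , eq₁) (off₂ , eq₂) (off₃ , eq₃) =
      map⊎ (λ x≡ → same-point off₁ off₂ eq₁ eq₂ x≡)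
        (map⊎ (λ x≡ → same-point off₁ off₃ eq₁ eq₃ x≡)
              (λ x≡ → same-point off₂ off₃ eq₂ eq₃ x≡))
        (quadratic-roots 1ℚ b d (λ ()) x₁ x₂ x₃
          (root y₁ (recompute (_ ≟ _) h₁) off₁ eq₁)
          (root y₂ (recompute (_ ≟ _) h₂) off₂ eq₂)
          (root y₃ (recompute (_ ≟ _) h₃) off₃ eq₃))
      where
      k b d : ℚ
      k = (κ * t) * (κ * t)
      b = - (e₂ + e₃ + k)
      d = e₂ * e₃ + k * e₁

      root : ∀ {x} y → y * y ≡ g x → x ≢ e₁ → y * inverse (κ * (x - e₁)) ≡ t →
             1ℚ * (x * x) + b * x + d ≡ 0ℚ
      root {x} y on-E x≢e₁ eq = combine₁ (- 1ℚ) (solve 5 (λ x k e₁ e₂ e₃ →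
        con 1ℚ :* (x :* x) :+ (:- (e₂ :+ e₃ :+ k)) :* x :+ (e₂ :* e₃ :+ k :* e₁)
          :- con 0ℚ :=
        con (- 1ℚ) :* (k :* (x :- e₁) :- (x :- e₂) :* (x :- e₃)))
        refl x k e₁ e₂ e₃) (slope-equation y on-E x≢e₁ eq)

      same-point : ∀ {x y x′ y′} .{h : y * y ≡ g x} .{h′ : y′ * y′ ≡ g x′} →
        x ≢ e₁ → x′ ≢ e₁ → y * inverse (κ * (x - e₁)) ≡ t →
        y′ * inverse (κ * (x′ - e₁)) ≡ t → x ≡ x′ → affine {E} x y h ≡ affine x′ y′ h′
      same-point {y = y} {y′ = y′} off off′ eq eq′ refl =
        affine-≡ refl (trans (slope-ordinate y off eq) (sym (slope-ordinate y′ off′ eq′)))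

    infinite-slopes : PositiveRank (pointGroup E) → Infinite (λ t → ∃[ x ] IsSlope t x)
    infinite-slopes rank ts =
      let t , (R , off , eq) , t∉ = infinite-image _≟_ normalised-slope slope-fibres
                                      (infinite-off-e₁ rank) ts in
      t , abscissa R off eq , t∉
      where
      abscissa : ∀ {t} R → Off-e₁ R → normalised-slope R ≡ t → ∃[ x ] IsSlope t x
      abscissa (affine x y h) off eq = x , slope-equation y (recompute (_ ≟ _) h) off eq

-- From points of the elliptic curve to the quartic and to z.

module Quartic (a c T : ℚ) (a≢0 : a ≢ 0ℚ) (c≢0 : c ≢ 0ℚ) (T≢0 : T ≢ 0ℚ) where

  open Rat using (_+_; _-_; -_; _*_; _÷_; ≢-nonZero)
  open +-*-Solver
  open Field

  E : Cubic
  E = cubic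
    (2ℚ * a * c * (T * T))
    (- (2ℚ * a * c * (T * T)))
    (2ℚ * a * c *
      (2ℚ * (a * a) * (T * T * T * T) + (4ℚ * a * c - 1ℚ) * (T * T)
        + 2ℚ * (c * c)))

  open Cubic E

  m κ : ℚ
  m = a * (T * T) + c
  κ = 2ℚ * a * m

  -- `IsSlope` for this cubic and this `κ`, written out so that ellipticity is not presupposed.
  IsAbscissa : ℚ → ℚ → Set
  IsAbscissa x X = (κ * x) * (κ * x) * (X - e₁) ≡ (X - e₂) * (X - e₃)

  q : ℚ → ℚ
  q x = a * (x * x) + c

  -- Since e₃ = 4 a c m² - 2 a c T², the difference e₂ - e₃ is -4 a c m².
  m≢0 : e₂ ≢ e₃ → m ≢ 0ℚ
  m≢0 e₂≢e₃ m≡0 = e₂≢e₃ (combine₁ (- (4ℚ * a * c * m)) (solve 3 (λ a c T →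
    let m = a :* (T :* T) :+ c in
    (:- (con 2ℚ :* a :* c :* (T :* T))) :- con 2ℚ :* a :* c :*
      (con 2ℚ :* (a :* a) :* (T :* T :* T :* T) :+ (con 4ℚ :* a :* c :- con 1ℚ) :* (T :* T)
        :+ con 2ℚ :* (c :* c)) :=
    (:- (con 4ℚ :* a :* c :* m)) :* (m :- con 0ℚ)) refl a c T) m≡0)

  -- Likewise e₁ - e₃ = -4 a c (m + T) (m - T).
  m≢T : e₁ ≢ e₃ → m ≢ T
  m≢T e₁≢e₃ m≡T = e₁≢e₃ (combine₁ (- (4ℚ * a * c * (T + m))) (solve 3 (λ a c T →
    let m = a :* (T :* T) :+ c in
    con 2ℚ :* a :* c :* (T :* T) :- con 2ℚ :* a :* c :*
      (con 2ℚ :* (a :* a) :* (T :* T :* T :* T) :+ (con 4ℚ :* a :* c :- con 1ℚ) :* (T :* T)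
        :+ con 2ℚ :* (c :* c)) :=
    (:- (con 4ℚ :* a :* c :* (T :+ m))) :* (m :- T)) refl a c T) m≡T)

  module Lift (m≢0 : m ≢ 0ℚ) (x X : ℚ) (x≢0 : x ≢ 0ℚ) (abscissa : IsAbscissa x X) where

    -- κ w, for w the second coordinate of the point of the quartic.
    root : ℚ
    root = 2ℚ * (m * m) * (a * a) * (x * x) + 2ℚ * a * c * (m * m - 2ℚ * (T * T)) - (X - e₁)

    -- Completing the square: `abscissa` is a monic quadratic in `X - e₁`, and `root` is half the
    -- sum of its roots minus `X - e₁`, so `root * root` is a quarter of its discriminant. The
    -- right-hand side is κ² times the discriminant of the quadratic for z.
    discriminant-square :
      root * root ≡ 4ℚ * (m * m) * (a * a) *
        (m * m * (q x * q x) - 4ℚ * a * c * (x * x) * (T * T))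
    discriminant-square = combine₁ (- 1ℚ) (solve 5 (λ a c T x X →
      let m  = a :* (T :* T) :+ c
          κ  = con 2ℚ :* a :* m
          e₁ = con 2ℚ :* a :* c :* (T :* T)
          e₂ = :- (con 2ℚ :* a :* c :* (T :* T))
          e₃ = con 2ℚ :* a :* c :*
            (con 2ℚ :* (a :* a) :* (T :* T :* T :* T)
              :+ (con 4ℚ :* a :* c :- con 1ℚ) :* (T :* T) :+ con 2ℚ :* (c :* c))
          q  = a :* (x :* x) :+ c
          n  = con 2ℚ :* (m :* m) :* (a :* a) :* (x :* x)
            :+ con 2ℚ :* a :* c :* (m :* m :- con 2ℚ :* (T :* T)) :- (X :- e₁)
      in
      n :* n :- con 4ℚ :* (m :* m) :* (a :* a) :*
        (m :* m :* (q :* q) :- con 4ℚ :* a :* c :* (x :* x) :* (T :* T)) :=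
      con (- 1ℚ) :* (κ :* x :* (κ :* x) :* (X :- e₁) :- (X :- e₂) :* (X :- e₃)))
      refl a c T x X) abscissa

    denominator : ℚ
    denominator = 4ℚ * (a * a) * m * T * x

    denominator≢0 : denominator ≢ 0ℚ
    denominator≢0 = *-≢0 (*-≢0 (*-≢0 (*-≢0 {4ℚ} (λ ()) (*-≢0 a≢0 a≢0)) m≢0) T≢0) x≢0

    -- The quadratic formula (q m + w) / (2 a T x) with w = root / κ, expanded by κ.
    z-of : ℚ
    z-of = (2ℚ * a * (m * m) * q x + root) ÷ denominator
      where instance _ = ≢-nonZero denominator≢0

    -- Multiplied by 4 a m `denominator`, the difference of the sides becomes (z d - r)² minus κ²
    -- times the discriminant, where d is `denominator` and r = 2 a m² q; the first term is
    -- `root * root`.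
    z-of-quadratic : a * T * x * (z-of * z-of) + c * T * x ≡ q x * m * z-of
    z-of-quadratic = *-cancelʳ
      (*-≢0 {4ℚ * a * m} (*-≢0 (*-≢0 {4ℚ} (λ ()) a≢0) m≢0) denominator≢0)
      (combine₂ (z-of * denominator - 2ℚ * a * (m * m) * q x + root) 1ℚ
        (solve 8 (λ a c T m x q n z →
          let d = con 4ℚ :* (a :* a) :* m :* T :* x
              k = con 4ℚ :* a :* m :* d
              r = con 2ℚ :* a :* (m :* m) :* q
          in
          (a :* T :* x :* (z :* z) :+ c :* T :* x) :* k :- q :* m :* z :* k :=
          (z :* d :- r :+ n) :* (z :* d :- (r :+ n)) :+
          con 1ℚ :* (n :* n :- con 4ℚ :* (m :* m) :* (a :* a) :*
            (m :* m :* (q :* q) :- con 4ℚ :* a :* c :* (x :* x) :* (T :* T))))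
          refl a c T m x (q x) root z-of)
        (÷-*-cancel (2ℚ * a * (m * m) * q x + root) denominator) discriminant-square)
      where instance _ = ≢-nonZero denominator≢0

    z-of≢0 : z-of ≢ 0ℚ
    z-of≢0 z≡0 = *-≢0 (*-≢0 c≢0 T≢0) x≢0
      (combine₂ 1ℚ (q x * m - a * T * x * z-of) (solve 7 (λ a c T m x q z →
        c :* T :* x :- con 0ℚ :=
        con 1ℚ :* (a :* T :* x :* (z :* z) :+ c :* T :* x :- q :* m :* z)
          :+ (q :* m :- a :* T :* x :* z) :* (z :- con 0ℚ))
        refl a c T m x (q x) z-of) z-of-quadratic z≡0)

    -- Putting z = x in the quadratic gives q x (m - T) = 0.
    x≢z-of : m ≢ T → q x ≢ 0ℚ → x ≢ z-of
    x≢z-of m≢T q≢0 x≡z = *-≢0 (*-≢0 q≢0 x≢0) (x-y≢0 m≢T)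
      (combine₂ (- 1ℚ) (- (a * T * x * (x + z-of) - q x * m)) (solve 6 (λ a c T m x z →
        let q = a :* (x :* x) :+ c in
        q :* x :* (m :- T) :- con 0ℚ :=
        con (- 1ℚ) :* (a :* T :* x :* (z :* z) :+ c :* T :* x :- q :* m :* z)
          :+ (:- (a :* T :* x :* (x :+ z) :- q :* m)) :* (x :- z))
        refl a c T m x z-of) z-of-quadratic x≡z)

    -- Putting z = T in the quadratic gives T m (q - x) = 0.
    T≢z-of : q x ≢ x → T ≢ z-of
    T≢z-of q≢x T≡z = *-≢0 (*-≢0 T≢0 m≢0) (x-y≢0 q≢x)
      (combine₂ (- 1ℚ) (q x * m - a * T * x * (T + z-of)) (solve 6 (λ a c T x q z →
        let m = a :* (T :* T) :+ c in
        T :* m :* (q :- x) :- con 0ℚ :=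
        con (- 1ℚ) :* (a :* T :* x :* (z :* z) :+ c :* T :* x :- q :* m :* z)
          :+ (q :* m :- a :* T :* x :* (T :+ z)) :* (T :- z))
        refl a c T x (q x) z-of) z-of-quadratic T≡z)

    -- The left side of the quadratic relation is T x q(z), so q(z) = 0 would make q(x) m z vanish.
    q[z-of]≢0 : q x ≢ 0ℚ → q z-of ≢ 0ℚ
    q[z-of]≢0 q≢0 qz≡0 = *-≢0 (*-≢0 q≢0 m≢0) z-of≢0
      (combine₂ (- 1ℚ) (T * x) (solve 7 (λ a c T m x q z →
        q :* m :* z :- con 0ℚ :=
        con (- 1ℚ) :* (a :* T :* x :* (z :* z) :+ c :* T :* x :- q :* m :* z)
          :+ T :* x :* (a :* (z :* z) :+ c :- con 0ℚ))
        refl a c T m x (q x) z-of) z-of-quadratic qz≡0)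

-- Return to the equation f(x) f(y) = f(z).

fromℤ-≢0 : ∀ n → n ≢ ℤ.0ℤ → fromℤ n ≢ 0ℚ
fromℤ-≢0 n n≢0 eq = n≢0 (trans (sym (ℚₚ.↥-/ n 1))
  (trans (cong (ℤ._* gcd n (+ 1)) (ℚₚ.p≡0⇒↥p≡0 (fromℤ n) eq))
    (ℤₚ.*-zeroˡ (gcd n (+ 1)))))

module _ (A C : ℤ) where

  open Rat using (_+_; _*_; _÷_; NonZero)
  open +-*-Solver
  open Field

  f-cleared : ∀ x .{{_ : NonZero x}} → f A C x * x ≡ fromℤ A * (x * x) + fromℤ C
  f-cleared x = trans
    (solve 3 (λ a x d → (a :* x :+ d) :* x := a :* (x :* x) :+ d :* x)
      refl (fromℤ A) x (fromℤ C ÷ x))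
    (cong (λ d → fromℤ A * (x * x) + d) (÷-*-cancel (fromℤ C) x))

module _ (A C : ℤ) (AC≢0 : A ℤ.* C ≢ ℤ.0ℤ) {T : ℚ} (T≢0 : T ≢ 0ℚ)
         (elliptic : IsElliptic (E₂ A C T)) where

  open Rat using (_+_; -_; _*_; NonZero; ≢-nonZero)
  open +-*-Solver
  open ℚₚ using (_≟_)
  open Field
  open IsElliptic elliptic

  private
    a c : ℚ
    a = fromℤ A
    c = fromℤ C

  a≢0 : a ≢ 0ℚ
  a≢0 = fromℤ-≢0 A λ { refl → AC≢0 (ℤₚ.*-zeroˡ C) }

  c≢0 : c ≢ 0ℚ
  c≢0 = fromℤ-≢0 C λ { refl → AC≢0 (ℤₚ.*-zeroʳ A) }

  open Quartic a c T a≢0 c≢0 T≢0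

  solution : ∀ x X → IsAbscissa x X → x ≢ 0ℚ → q x ≢ 0ℚ → q x ≢ x →
             ∃[ z ] NontrivialSolution A C x T z
  solution x X abscissa x≢0 q≢0 q≢x = z-of , record
    -- Multiplied by x T z, the equation reads q(x) m z = q(z) x T, which is `z-of-quadratic`
    -- rearranged.
    { equation = *-cancelʳ (*-≢0 (*-≢0 x≢0 T≢0) z-of≢0) (trans
        (solve 5 (λ fx fT x T z → fx :* fT :* (x :* T :* z) := fx :* x :* (fT :* T) :* z)
          refl (f A C x) (f A C T) x T z-of)
        (trans (cong₂ (λ q m → q * m * z-of) (f-cleared A C x) (f-cleared A C T))
        (trans (sym z-of-quadratic)
        (trans (solve 5 (λ a c T x z → a :* T :* x :* (z :* z) :+ c :* T :* x :=
            (a :* (z :* z) :+ c) :* (x :* T)) refl a c T x z-of)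
        (trans (cong (_* (x * T)) (sym (f-cleared A C z-of)))
          (solve 4 (λ fz x T z → fz :* z :* (x :* T) := fz :* (x :* T :* z))
            refl (f A C z-of) x T z-of))))))
    ; x≢z = x≢z-of (m≢T e₁≢e₃) q≢0
    ; y≢z = T≢z-of q≢x
    ; f[z]≢0 = λ fz≡0 → q[z-of]≢0 q≢0
        (trans (sym (f-cleared A C z-of)) (trans (cong (_* z-of) fz≡0) (ℚₚ.*-zeroˡ z-of)))
    }
    where
    open Lift (m≢0 e₂≢e₃) x X x≢0 abscissa
    instance
      x-nonZero : NonZero x
      x-nonZero = ≢-nonZero x≢0
      T-nonZero : NonZero T
      T-nonZero = ≢-nonZero T≢0
      z-nonZero : NonZero z-of
      z-nonZero = ≢-nonZero z-of≢0

  -- Nested to the left to match three successive uses of `infinite-avoiding`.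
  Admissible : ℚ → Set
  Admissible x = (((∃[ X ] IsAbscissa x X) × x ≢ 0ℚ) × q x ≢ 0ℚ) × q x ≢ x

  infinite-admissible : PositiveRank (pointGroup (E₂ A C T)) → Infinite Admissible
  infinite-admissible rank =
    infinite-avoiding (λ x → q x ≟ x) q≡x≤2
      (infinite-avoiding (λ x → q x ≟ 0ℚ) q≡0≤2
        (infinite-avoiding (_≟ 0ℚ) (λ { (_ , refl) (_ , refl) _ → inj₁ refl })
          (infinite-slopes rank)))
    where
    open ChordTangent (E₂ A C T) elliptic
    open Slopes {κ} (*-≢0 (*-≢0 {2ℚ} (λ ()) a≢0) (m≢0 e₂≢e₃)) using (infinite-slopes)

    q≡0≤2 : {P : ℚ → Set} → AtMostTwo (λ x → P x × q x ≡ 0ℚ)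
    q≡0≤2 {x = r} {y = s} {z = t} (_ , p₁) (_ , p₂) (_ , p₃) =
      quadratic-roots a 0ℚ c a≢0 r s t (root′ r p₁) (root′ s p₂) (root′ t p₃)
      where
      root′ : ∀ x → q x ≡ 0ℚ → a * (x * x) + 0ℚ * x + c ≡ 0ℚ
      root′ x = combine₁ 1ℚ (solve 3 (λ a c x →
        a :* (x :* x) :+ con 0ℚ :* x :+ c :- con 0ℚ :=
        con 1ℚ :* (a :* (x :* x) :+ c :- con 0ℚ)) refl a c x)

    q≡x≤2 : {P : ℚ → Set} → AtMostTwo (λ x → P x × q x ≡ x)
    q≡x≤2 {x = r} {y = s} {z = t} (_ , p₁) (_ , p₂) (_ , p₃) =
      quadratic-roots a (- 1ℚ) c a≢0 r s t (root′ r p₁) (root′ s p₂) (root′ t p₃)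
      where
      root′ : ∀ x → q x ≡ x → a * (x * x) + (- 1ℚ) * x + c ≡ 0ℚ
      root′ x = combine₁ 1ℚ (solve 3 (λ a c x →
        a :* (x :* x) :+ con (- 1ℚ) :* x :+ c :- con 0ℚ :=
        con 1ℚ :* (a :* (x :* x) :+ c :- x)) refl a c x)

open import Data.Integer.Base using (0ℤ; _*_)

theorem1p2 : (A C : ℤ) → A * C ≢ 0ℤ →
    ∃[ T ] (T ≢ 0ℚ × IsElliptic (E₂ A C T) × PositiveRank (pointGroup (E₂ A C T))) →
    Infinite {ℚ × ℚ × ℚ} (λ (x , y , z) → NontrivialSolution A C x y z)
theorem1p2 A C AC≢0 (T , T≢0 , elliptic , rank) xs =
  let x , ((((X , abscissa) , x≢0) , q≢0) , q≢x) , x∉ =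
        -- Avoiding all first coordinates in `xs` already makes the triple new.
        infinite-admissible A C AC≢0 T≢0 elliptic rank (map proj₁ xs)
      z , nontrivial = solution A C AC≢0 T≢0 elliptic x X abscissa x≢0 q≢0 q≢x
  in (x , T , z) , nontrivial , x∉ ∘ ∈-map⁺ proj₁
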